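{- There exists a non-terminating game of two-player Beggar-My-Neighbor with a standard 52-card deck dealt equally (26 cards to each player). Explicitly, consider the starting deal (top card of each hand at the left; player 1 starts) Player 1: $\texttt{ ---K---Q-KQAJ-----AAJ--J-- }$ Player 2: $\texttt{ ----------Q----KQ-J-----KA}$ The game from this deal never terminates. After 4 tricks it enters a cycle of 62 tricks, of which the first repeating state is Player 1: $\texttt{ ---AAJ--J--------K---------Q-Q-K---Q-KAQJ- }$ Player 2: $\texttt{ -----KA-J- }$ with player 2 to play next. That is, after 4 tricks the game is in this state, and it returns to this state for the first time after 62 further tricks and hence every 62 tricks thereafter, while none of the states before the fourth trick is completed belongs to the cycle.
   Context: Cards and hands. Suits are irrelevant. A card is one of: an ace $\texttt{A}$, a king $\texttt{K}$, a queen $\texttt{Q}$, a jack $\texttt{J}$ (these four types are the court, or face, cards), or a number card, written $\texttt{ - }$. A standard deck has 52 cards: 4 each of $\texttt{A},\texttt{K},\texttt{Q},\texttt{J}$ and 36 number cards. A hand (pack) is a finite sequence of cards, written as a string with the top of the hand (next card to be played) at the left. In the strings, each single hyphen is one number card. State. A state (between tricks) consists of the hand of player 1, the hand of player 2, and which player is to play next (start the next trick). Rules of Beggar-My-Neighbor. The player to start lays the top card of his hand face up on the (initially empty) table pile; the players then alternate, each laying the top card of his hand on the pile, as long as no court card appears. When a player lays a court card, his opponent has to pay: he must lay up to 4 cards in succession for an ace, 3 for a king, 2 for a queen, 1 for a jack, taken from the top of his hand. If all the required cards are number cards, the player who laid the court card wins the trick. If during the payment a court card is laid, the payment stops at once and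 the roles are reversed: the other player now has to pay to this new court card in the same way; the trick continues until some player pays in full with number cards only. The winner of the trick takes the whole pile and places it under (at the bottom of) his hand, in the order the cards were played (the first card played in the trick is nearest the top, so in string notation the pile, written in order of play, is appended at the right end of the winner's string). The winner of the trick starts the next trick. Termination. The game terminates if one player gets all the cards (in particular if a player who must lay a card has none left, in which case his opponent gets all the cards and wins). A game is non-terminating if it continues through infinitely many tricks. Play is deterministic. -}

module Defs where

open import Data.List.Base using (List; []; _∷_; _++_; _∷ʳ_; length; replicate)
open import Data.List.Relation.Binary.Permutation.Propositional using (_↭_)
open import Data.Nat.Base using (ℕ; zero; suc)
open import Data.Product.Base using (_×_; ∃-syntax)
open import Relation.Binary.PropositionalEquality.Core using (_≡_)

data Court : Set where
  ace king queen jack : Court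

data Card : Set where
  court  : Court → Card
  number : Card

-- The head of the list is the top of the hand, i.e. the next card to be played.
Hand : Set
Hand = List Card

data Player : Set where
  player₁ player₂ : Player

opponent : Player → Player
opponent player₁ = player₂
opponent player₂ = player₁

record State : Set where
  constructor state
  field
    hand₁  : Hand
    hand₂  : Hand
    toPlay : Player

open State public

payment : Court → ℕ
payment ace   = 4
payment king  = 3
payment queen = 2
payment jack  = 1

-- 'won p' : the game is over and p has all the cards.
data Outcome : Set where
  won       : Player → Outcome
  continues : State → Outcome

-- 'takes w hw hl pile' : w, holding hw, wins the trick against an opponent
-- holding hl; pile is listed in the order in which its cards were played.
takes : Player → Hand → Hand → List Card → Outcome
takes w       hw []           pile = won w
takes player₁ hw hl@(_ ∷ _) pile = continues (state (hw ++ pile) hl player₁)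
takes player₂ hw hl@(_ ∷ _) pile = continues (state hl (hw ++ pile) player₂)

-- What the player about to act has to do: 'free' when no court card is on the
-- table, 'owes n' when n more cards are due to the opponent's court card.
data Duty : Set where
  free : Duty
  owes : ℕ → Duty

-- 'lay p d xs ys pile' : the rest of a trick, when p is about to act with duty d
-- and holds xs, the opponent of p holds ys, and pile lies on the table.
lay : Player → Duty → Hand → Hand → List Card → Outcome
lay p (owes zero)    xs             ys pile = takes (opponent p) ys xs pile
lay p free           []             ys pile = won (opponent p)
lay p (owes (suc n)) []             ys pile = won (opponent p)
lay p free           (number ∷ xs)  ys pile = lay (opponent p) free ys xs (pile ∷ʳ number)
lay p (owes (suc n)) (number ∷ xs)  ys pile = lay p (owes n) xs ys (pile ∷ʳ number)
lay p free           (court c ∷ xs) ys pile =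
  lay (opponent p) (owes (payment c)) ys xs (pile ∷ʳ court c)
lay p (owes (suc n)) (court c ∷ xs) ys pile =
  lay (opponent p) (owes (payment c)) ys xs (pile ∷ʳ court c)

trick : State → Outcome
trick (state h₁ h₂ player₁) = lay player₁ free h₁ h₂ []
trick (state h₁ h₂ player₂) = lay player₂ free h₂ h₁ []

andThen : Outcome → (State → Outcome) → Outcome
andThen (won p)       f = won p
andThen (continues s) f = f s

afterTricks : ℕ → State → Outcome
afterTricks zero    s = continues s
afterTricks (suc n) s = andThen (afterTricks n s) trick

NonTerminating : State → Set
NonTerminating s = ∀ n → ∃[ t ] afterTricks n s ≡ continues t

standardDeck : List Card
standardDeck =
  replicate 4 (court ace)   ++ replicate 4 (court king) ++
  replicate 4 (court queen) ++ replicate 4 (court jack) ++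
  replicate 36 number

IsEqualDeal : State → Set
IsEqualDeal s =
  (hand₁ s ++ hand₂ s ↭ standardDeck) × length (hand₁ s) ≡ 26 × length (hand₂ s) ≡ 26

-- The orbit of s under tricks; this is the cycle through s when s recurs.
_∈OrbitOf_ : State → State → Set
t ∈OrbitOf s = ∃[ k ] afterTricks k s ≡ continues t

module HandNotation where

  infixr 5 A_ K_ Q_ J_ -_

  A_ K_ Q_ J_ -_ : Hand → Hand
  A xs = court ace ∷ xs
  K xs = court king ∷ xs
  Q xs = court queen ∷ xs
  J xs = court jack ∷ xs
  - xs = number ∷ xs

  ∎ : Hand
  ∎ = []

startingDeal : State
startingDeal = state
  (- - - K - - - Q - K Q A J - - - - - A A J - - J - - ∎)
  (- - - - - - - - - - Q - - - - K Q - J - - - - - K A ∎)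
  player₁
  where open HandNotation

cycleState : State
cycleState = state
  (- - - A A J - - J - - - - - - - - K - - - - - - - - - Q - Q - K - - - Q - K A Q J - ∎)
  (- - - - - K A - J - ∎)
  player₂
  where open HandNotation

{-# OPTIONS --safe #-}
-- The play from each of the two states is computed. Periodicity makes the state
-- after k tricks depend only on k modulo 62, so that disjointness of the first
-- four states from the cycle is a finite check; and a deal that continues after
-- arbitrarily large numbers of tricks has not stopped before.
module Submission where

open import Data.Nat.Base using (ℕ; _+_; _*_; _<_)
open import Data.Product.Base using (_×_; ∃-syntax)
open import Relation.Binary.PropositionalEquality.Core using (_≡_; _≢_)
open import Relation.Nullary.Negation.Core using (¬_)
open import Defs

open import Data.List.Base using (_++_)
open import Data.List.Properties using () renaming (≡-dec to List-≡-dec)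
open import Data.List.Relation.Binary.Permutation.Propositional using (↭-sym)
open import Data.List.Sort.Base using (module SortingAlgorithm)
import Data.List.Sort.InsertionSort as InsertionSort
open import Data.Nat.Base using (zero; suc; NonZero; _≤_; _∸_; _/_; _%_)
open import Data.Nat.DivMod using (m≡m%n+[m/n]*n; m%n<n)
open import Data.Nat.Properties
  using (≤-decTotalOrder; eq?; allUpTo?; >⇒≢; m∸n+n≡m; m≤m*n; m≤n+m; ≤-trans; +-comm)
  renaming (_≟_ to _≟ℕ_)
open import Data.Product.Base using (_,_)
open import Function.Bundles using (mk↣)
open import Relation.Binary.Bundles using (DecTotalOrder)
open import Relation.Binary.Definitions using (DecidableEquality)
import Relation.Binary.Construct.On as On
open import Relation.Binary.PropositionalEquality using (refl; sym; trans; cong; subst)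
open import Relation.Nullary.Decidable
  using (yes; no; map′; _×-dec_; _→-dec_; ¬?; from-yes)

-- Serves twice: injectivity pulls decidable equality of cards back from `ℕ`, and pulling back `≤`
-- gives the order used for sorting.
rank : Card → ℕ
rank (court ace)   = 0
rank (court king)  = 1
rank (court queen) = 2
rank (court jack)  = 3
rank number        = 4

rank-injective : ∀ {c d} → rank c ≡ rank d → c ≡ d
rank-injective {court ace}   {court ace}   refl = refl
rank-injective {court king}  {court king}  refl = refl
rank-injective {court queen} {court queen} refl = refl
rank-injective {court jack}  {court jack}  refl = refl
rank-injective {number}      {number}      refl = refl
rank-injective {number}      {court ace}   ()

infix 4 _≟Card_ _≟Hand_ _≟Player_ _≟State_ _≟_

_≟Card_ : DecidableEquality Card
_≟Card_ = eq? (mk↣ rank-injective)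

_≟Hand_ : DecidableEquality Hand
_≟Hand_ = List-≡-dec _≟Card_

_≟Player_ : DecidableEquality Player
player₁ ≟Player player₁ = yes refl
player₁ ≟Player player₂ = no λ ()
player₂ ≟Player player₁ = no λ ()
player₂ ≟Player player₂ = yes refl

_≟State_ : DecidableEquality State
state h₁ h₂ p ≟State state h₁′ h₂′ p′ =
  map′ (λ { (refl , refl , refl) → refl }) (λ { refl → refl , refl , refl })
    (h₁ ≟Hand h₁′ ×-dec h₂ ≟Hand h₂′ ×-dec p ≟Player p′)

_≟_ : DecidableEquality Outcome
won p       ≟ won q       = map′ (cong won) (λ { refl → refl }) (p ≟Player q)
won p       ≟ continues t = no λ ()
continues s ≟ won q       = no λ ()
continues s ≟ continues t = map′ (cong continues) (λ { refl → refl }) (s ≟State t)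

cardOrder : DecTotalOrder _ _ _
cardOrder = On.decTotalOrder ≤-decTotalOrder rank

open SortingAlgorithm (InsertionSort.insertionSort cardOrder) using (sort-↭)

-- standardDeck is listed by increasing rank, so sorting the deal computes to it.
startingDeal-isEqualDeal : IsEqualDeal startingDeal
startingDeal-isEqualDeal =
  ↭-sym (sort-↭ (hand₁ startingDeal ++ hand₂ startingDeal)) , refl , refl

andThen-assoc : ∀ o f g → andThen (andThen o f) g ≡ andThen o (λ s → andThen (f s) g)
andThen-assoc (won p)       f g = refl
andThen-assoc (continues s) f g = refl

-- `afterTricks` applies its last trick outermost, so the induction is on `m`, the tricks played
-- later. The base case is the right unit law of `andThen`, which needs the case split.
afterTricks-+ : ∀ m n s → afterTricks (m + n) s ≡ andThen (afterTricks n s) (afterTricks m)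
afterTricks-+ zero n s with afterTricks n s
... | won p       = refl
... | continues t = refl
afterTricks-+ (suc m) n s =
  trans (cong (λ o → andThen o trick) (afterTricks-+ m n s))
        (andThen-assoc (afterTricks n s) (afterTricks m) trick)

afterTricks-resume : ∀ m {n s t} → afterTricks n s ≡ continues t →
                     afterTricks (m + n) s ≡ afterTricks m t
afterTricks-resume m {n} {s} eq =
  trans (afterTricks-+ m n s) (cong (λ o → andThen o (afterTricks m)) eq)

continues-earlier : ∀ {m n s t} → m ≤ n → afterTricks n s ≡ continues t →
                    ∃[ u ] afterTricks m s ≡ continues u
continues-earlier {m} {n} {s} m≤n eq
  with afterTricks m s | afterTricks-+ (n ∸ m) m s
... | continues u | _    = u , refl
-- A win is absorbing: `won′` says that the game would still be won after `n` tricks, against `eq`.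
... | won p       | won′
  with () ← trans (sym won′) (subst (λ k → afterTricks k s ≡ _) (sym (m∸n+n≡m m≤n)) eq)

module _ {p s} (period : afterTricks p s ≡ continues s) where

  afterTricks-*-period : ∀ m → afterTricks (m * p) s ≡ continues s
  afterTricks-*-period zero    = refl
  afterTricks-*-period (suc m) = trans (afterTricks-resume p (afterTricks-*-period m)) period

  -- The `k / p` full periods are played first and lead back to `s`; only the remainder is left.
  afterTricks-%-period : .{{_ : NonZero p}} → ∀ k → afterTricks k s ≡ afterTricks (k % p) s
  afterTricks-%-period k =
    trans (cong (λ j → afterTricks j s) (m≡m%n+[m/n]*n k p))
          (afterTricks-resume (k % p) (afterTricks-*-period (k / p)))

start⇒cycle : afterTricks 4 startingDeal ≡ continues cycleState
start⇒cycle = refl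

cycle-period : afterTricks 62 cycleState ≡ continues cycleState
cycle-period = refl

cycle-minimal : ∀ k → 0 < k → k < 62 → afterTricks k cycleState ≢ continues cycleState
cycle-minimal k 0<k k<62 = noReturn k<62 (>⇒≢ 0<k)
  where
  -- Restated in the form decided by `allUpTo?`: the bound comes first, and positivity becomes a
  -- decidable premise excluding the trivial return at 0.
  noReturn : ∀ {k} → k < 62 → k ≢ 0 → afterTricks k cycleState ≢ continues cycleState
  noReturn = from-yes (allUpTo? (λ k →
    ¬? (k ≟ℕ 0) →-dec ¬? (afterTricks k cycleState ≟ continues cycleState)) 62)

start⇒cycle-again : ∀ m → afterTricks (4 + m * 62) startingDeal ≡ continues cycleState
start⇒cycle-again m =
  -- `afterTricks-resume` expects the tricks played first as the right summand.
  trans (cong (λ k → afterTricks k startingDeal) (+-comm 4 (m * 62)))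
        (trans (afterTricks-resume (m * 62) start⇒cycle) (afterTricks-*-period cycle-period m))

startingDeal-nonTerminating : NonTerminating startingDeal
startingDeal-nonTerminating n =
  -- The `n`-th return to `cycleState` happens no earlier than trick `n`, which supplies the
  -- required later continuation.
  continues-earlier (≤-trans (m≤m*n n 62) (m≤n+m (n * 62) 4)) (start⇒cycle-again n)

-- A table of 4 × 62 evaluations. Comparing outcomes avoids naming the intermediate states.
start-disjoint : ∀ {i} → i < 4 → ∀ {j} → j < 62 →
                 afterTricks j cycleState ≢ afterTricks i startingDeal
start-disjoint = from-yes (allUpTo? (λ i → allUpTo? (λ j →
  ¬? (afterTricks j cycleState ≟ afterTricks i startingDeal)) 62) 4)

start-outside-cycle : ∀ i → i < 4 → ∀ t → afterTricks i startingDeal ≡ continues t →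
                      ¬ (t ∈OrbitOf cycleState)
start-outside-cycle i i<4 t start⇒t (k , cycle⇒t) =
  -- Periodicity replaces the arbitrary `k` by its residue, which lies in the table.
  start-disjoint i<4 (m%n<n k 62)
    (trans (sym (afterTricks-%-period cycle-period k)) (trans cycle⇒t (sym start⇒t)))

mainTheorem1 : (∃[ s ] IsEqualDeal s × NonTerminating s)
    × IsEqualDeal startingDeal
    × NonTerminating startingDeal
    × afterTricks 4 startingDeal ≡ continues cycleState
    × afterTricks 62 cycleState ≡ continues cycleState
    × (∀ k → 0 < k → k < 62 → afterTricks k cycleState ≢ continues cycleState)
    × (∀ m → afterTricks (4 + m * 62) startingDeal ≡ continues cycleState)
    × (∀ i → i < 4 → ∀ t → afterTricks i startingDeal ≡ continues t → ¬ (t ∈OrbitOf cycleState))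
mainTheorem1 =
    (startingDeal , startingDeal-isEqualDeal , startingDeal-nonTerminating)
  , startingDeal-isEqualDeal
  , startingDeal-nonTerminating
  , start⇒cycle
  , cycle-period
  , cycle-minimal
  , start⇒cycle-again
  , start-outside-cycle
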